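{- Let $K$ be a triangulated closed surface, let $\zeta$ be a nontrivial (non-bounding) $1$-cycle of $K$ with $\mathbb{Z}_2$ coefficients, and let $\eta$ be a connected $1$-cocycle of $K$. The following are equivalent: (a) $\eta$ is a feasible set for the input cycle $\zeta$; (b) every cycle in the homology class $[\zeta]$ intersects $\eta$ in an odd number of edges; (c) there exists a cycle in $[\zeta]$ that intersects $\eta$ in an odd number of edges.
   Context: Homology and cohomology are simplicial with $\mathbb{Z}_2$ coefficients; $p$-chains and $p$-cochains are identified with sets of $p$-simplices. The dual graph $D_K$ of $K$ has a node for every $2$-simplex and an edge connecting two nodes whenever the corresponding $2$-simplices are incident on a common edge of $K$; thus every edge of $K$ corresponds to an edge of $D_K$. A cocycle $\eta$ is connected if the edges of $\eta$, viewed as edges of the dual graph, induce a connected subgraph of $D_K$. A cocycle $\eta$ is a feasible set (for $\zeta$) if every cycle $\zeta'\in[\zeta]$ meets $\eta$ in an edge. -}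

module Defs where

open import Level using (0ℓ)
open import Data.Bool.Base using (_xor_)
open import Data.Fin.Base using (Fin)
open import Data.Fin.Subset using (Subset; inside; outside; _∈_; _⊆_; _∩_; _∪_; ∣_∣; ⊥; Nonempty)
open import Data.Fin.Subset.Properties
  using (nonempty?; _⊆?_; x∈p∩q⁺; x∈p∩q⁻; x∈p∪q⁺; x∈p∪q⁻)
open import Data.List.Base using (List; []; _∷_; _++_; map; filter; length; lookup)
open import Data.Nat.Base using (ℕ; zero; suc; _≤_; parity)
open import Data.Nat.Properties using () renaming (_≟_ to _≟ℕ_)
open import Data.Parity.Base using (1ℙ)
open import Data.Parity.Properties using () renaming (_≟_ to _≟ℙ_)
open import Data.Product using (_×_; _,_; ∃-syntax)
open import Data.Sum.Base using (inj₂; map₂)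
open import Data.Vec.Base using (tabulate; zipWith)
import Data.Vec.Base as Vec
open import Relation.Binary.Construct.Closure.ReflexiveTransitive using (Star)
open import Relation.Binary.PropositionalEquality using (_≡_; _≢_)
open import Relation.Nullary using (¬_; does; ¬?; _×-dec_)
open import Relation.Unary using (Pred; Decidable; U)

Odd : ℕ → Set
Odd k = parity k ≡ 1ℙ

odd? : Decidable Odd
odd? k = parity k ≟ℙ 1ℙ

infixl 6 _⊕_

-- Sum of chains with ℤ₂ coefficients.
_⊕_ : ∀ {m} → Subset m → Subset m → Subset m
_⊕_ = zipWith _xor_

record Graph : Set₁ where
  field
    Node  : Set
    Edge  : Set
    Joins : Edge → Node → Node → Set

module _ (G : Graph) where
  open Graph G

  AdjacentVia : Pred Edge 0ℓ → Node → Node → Set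
  AdjacentVia S x y = ∃[ e ] S e × Joins e x y

  -- The subgraph induced by a set S of edges consists of the edges in S and
  -- their endpoints.
  InducesConnected : Pred Edge 0ℓ → Set
  InducesConnected S = ∀ {x x′ y y′} →
    AdjacentVia S x x′ → AdjacentVia S y y′ → Star (AdjacentVia S) x y

  Connected : Set
  Connected = ∀ x y → Star (AdjacentVia U) x y

-- Finite abstract simplicial complexes with vertices among Fin n.  Not every
-- element of Fin n need be a vertex, so that links live over the same Fin n.
record SimplicialComplex (n : ℕ) : Set₁ where
  field
    Face        : Pred (Subset n) 0ℓ
    Face?       : Decidable Face
    nonempty    : ∀ {σ} → Face σ → Nonempty σ
    down-closed : ∀ {σ τ} → Face σ → Nonempty τ → τ ⊆ σ → Face τ

subsets : ∀ n → List (Subset n)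
subsets zero    = Vec.[] ∷ []
subsets (suc n) = map (outside Vec.∷_) (subsets n) ++ map (inside Vec.∷_) (subsets n)

module _ {n : ℕ} (K : SimplicialComplex n) where
  open SimplicialComplex K

  simplices : ℕ → List (Subset n)
  simplices p = filter (λ σ → Face? σ ×-dec (∣ σ ∣ ≟ℕ suc p)) (subsets n)

  Simplex : ℕ → Set
  Simplex p = Fin (length (simplices p))

  vertices : ∀ {p} → Simplex p → Subset n
  vertices {p} = lookup (simplices p)

  -- A chain or cochain is a set of p-simplices.
  Chain Cochain : ℕ → Set
  Chain p   = Subset (length (simplices p))
  Cochain p = Subset (length (simplices p))

  facets : ∀ p → Simplex (suc p) → Chain p
  facets p τ = tabulate λ (σ : Simplex p) → does (vertices {p} σ ⊆? vertices {suc p} τ)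

  cofacets : ∀ p → Simplex p → Cochain (suc p)
  cofacets p σ = tabulate λ (τ : Simplex (suc p)) → does (vertices {p} σ ⊆? vertices {suc p} τ)

  -- The coefficient of σ in ∂ c is the number mod 2 of simplices of c having
  -- σ as a facet; dually for δ.
  ∂ : ∀ p → Chain (suc p) → Chain p
  ∂ p c = tabulate λ σ → does (odd? ∣ c ∩ cofacets p σ ∣)

  δ : ∀ p → Cochain p → Cochain (suc p)
  δ p c = tabulate λ τ → does (odd? ∣ c ∩ facets p τ ∣)

  Is1Cycle : Chain 1 → Set
  Is1Cycle ζ = ∂ 0 ζ ≡ ⊥

  Is1Boundary : Chain 1 → Set
  Is1Boundary ζ = ∃[ c ] ζ ≡ ∂ 1 c

  Is1Cocycle : Cochain 1 → Set
  Is1Cocycle η = δ 1 η ≡ ⊥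

  HomologyClass : Chain 1 → Pred (Chain 1) 0ℓ
  HomologyClass ζ ζ′ = Is1Cycle ζ′ × Is1Boundary (ζ ⊕ ζ′)

  oneSkeleton : Graph
  oneSkeleton = record
    { Node  = Simplex 0
    ; Edge  = Simplex 1
    ; Joins = λ e v w → v ≢ w × v ∈ facets 0 e × w ∈ facets 0 e
    }

  dualGraph : Graph
  dualGraph = record
    { Node  = Simplex 2
    ; Edge  = Simplex 1
    ; Joins = λ e s t → s ≢ t × s ∈ cofacets 1 e × t ∈ cofacets 1 e
    }

  ConnectedCocycle : Cochain 1 → Set
  ConnectedCocycle η = Is1Cocycle η × InducesConnected dualGraph (_∈ η)

  Feasible : Chain 1 → Cochain 1 → Set
  Feasible ζ η = ∀ ζ′ → HomologyClass ζ ζ′ → Nonempty (ζ′ ∩ η)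

  Link : Subset n → SimplicialComplex n
  Link σ = record
    { Face        = λ τ → Nonempty τ × ¬ Nonempty (σ ∩ τ) × Face (σ ∪ τ)
    ; Face?       = λ τ → nonempty? τ ×-dec ¬? (nonempty? (σ ∩ τ)) ×-dec Face? (σ ∪ τ)
    ; nonempty    = λ (ne , _) → ne
    ; down-closed = λ {τ} {ρ} (_ , disjoint , face) ne@(x , x∈ρ) ρ⊆τ →
          ne
        , (λ (y , y∈) → let (y∈σ , y∈ρ) = x∈p∩q⁻ σ ρ y∈
                        in disjoint (y , x∈p∩q⁺ (y∈σ , ρ⊆τ y∈ρ)))
        , down-closed face (x , x∈p∪q⁺ (inj₂ x∈ρ))
            (λ y∈ → x∈p∪q⁺ (map₂ ρ⊆τ (x∈p∪q⁻ σ ρ y∈)))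
    }

-- A triangulated circle: a nonempty connected graph with all degrees 2.
record IsCircle {n} (L : SimplicialComplex n) : Set where
  field
    dim≤1     : ∀ {σ} → SimplicialComplex.Face L σ → ∣ σ ∣ ≤ 2
    vertex    : Simplex L 0
    degree    : ∀ v → ∣ cofacets L 0 v ∣ ≡ 2
    connected : Connected (oneSkeleton L)

-- A finite complex triangulates a closed surface (compact 2-manifold without
-- boundary, not assumed connected) iff all its vertex links are circles.  This
-- makes every simplex a face of a triangle, and every edge a face of exactly
-- two triangles.
IsClosedSurface : ∀ {n} → SimplicialComplex n → Set
IsClosedSurface K = ∀ (v : Simplex K 0) → IsCircle (Link K (vertices K {0} v))

{-# OPTIONS --safe #-}
module Submission where

-- The parity of the intersection of a chain and a cochain is a ℤ₂-bilinear
-- form _·_ for which ∂ and δ are adjoint.  As δ η = 0, boundaries pair to zero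
-- with η, so all cycles of a homology class meet η in the same parity
-- (class-parity).  This makes "some cycle is odd" and "every cycle is odd"
-- equivalent, and an odd intersection is nonempty, so η is then feasible.
--
-- Conversely let η be feasible and suppose that some ζ′ homologous to ζ meets η
-- in an even number of edges.  A triangle has three edges, an even number of
-- them in η, so if it contains distinct edges e and e′ of η, its boundary meets
-- η exactly in e and e′ (trace-triangle).  Any two edges of η are joined by a
-- path of triangles crossing edges of η, because η is connected and every edge
-- of a closed surface belongs to two triangles (edge-in-two-triangles).  The
-- boundaries of the triangles on the path telescope to a boundary meeting η in
-- just the two given edges (trace-path).  Pairing up the edges of ζ′ ∩ η
-- produces a boundary ∂ c with ∂ c ∩ η = ζ′ ∩ η (trace-even).  Then ζ′ ⊕ ∂ c is
-- a cycle, since ∂ ∂ = 0, is homologous to ζ, and avoids η: a contradiction.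
--
-- The numbers of facets of a triangle and of edges between a vertex and a
-- triangle, which the argument and ∂ ∂ = 0 need, are binomial coefficients
-- counting the sets of given size in an interval of subsets (count-between).

open import Defs
open import Algebra.Bundles using (CommutativeRing)
open import Data.Bool.Base using (Bool; true; false; not; _∧_; _xor_)
open import Data.Bool.Properties
  using (∧-assoc; ∧-comm; ∧-distribʳ-xor; xor-assoc; xor-identityˡ;
         xor-identityʳ; xor-same; xor-∧-commutativeRing)
open import Data.Fin.Base using (Fin; zero; suc)
open import Data.Fin.Properties using () renaming (_≟_ to _≟ᶠ_)
open import Data.Fin.Subset
  using (Subset; inside; outside; _∈_; _∉_; _⊆_; _∩_; _∪_; _─_; _-_; _⊂_; ∣_∣; ⊥; ⁅_⁆; Nonempty; Empty)
open import Data.Fin.Subset.Induction using (⊂-wellFounded; Acc; acc)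
open import Data.Fin.Subset.Properties
open import Data.List.Base as List using (List; []; _∷_; _++_; filter; length)
open import Data.List.Membership.Propositional using () renaming (_∈_ to _∈ᴸ_)
open import Data.List.Membership.Propositional.Properties
  using (∈-filter⁺; ∈-filter⁻; ∈-lookup; ∈-map⁺; ∈-map⁻; ∈-++⁺ˡ; ∈-++⁺ʳ)
open import Data.List.Properties using (filter-++; filter-≐; filter-none; length-++)
open import Data.List.Relation.Unary.All as All using (All)
open import Data.List.Relation.Unary.Any as Any using (here; there)
open import Data.List.Relation.Unary.Any.Properties using (lookup-index)
open import Data.List.Relation.Unary.AllPairs using ([]; _∷_)
open import Data.List.Relation.Unary.Unique.Propositional using (Unique)
import Data.List.Relation.Unary.Unique.Propositional.Properties as Uniqueₚ
open import Data.Nat.Base using (ℕ; zero; suc; _+_; _≤_; z≤n; s≤s; s≤s⁻¹)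
open import Data.Nat.Combinatorics using (_C_; nCk+nC[k+1]≡[n+1]C[k+1])
open import Data.Nat.Properties
  using (suc-injective; +-suc; +-comm; +-identityʳ; 1+n≰n)
  renaming (_≟_ to _≟ℕ_)
open import Data.Product using (_×_; _,_; proj₁; proj₂; ∃-syntax; ∃₂)
open import Data.Sum.Base using (inj₁; inj₂; map₂)
open import Data.Vec.Base using ([]; _∷_; lookup; tabulate; here; there)
open import Data.Vec.Properties
  using (lookup⇒[]=; []=⇒lookup; lookup∘tabulate; tabulate∘lookup; tabulate-cong; lookup-zipWith;
         lookup-replicate; zipWith-assoc; zipWith-identityˡ; zipWith-identityʳ;
         zipWith-distribʳ; ∷-injective)
open import Function.Base using (_∘_)
open import Function.Bundles using (_⇔_; mk⇔)
open import Level using (0ℓ)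
open import Relation.Binary.Construct.Closure.ReflexiveTransitive using (Star; ε; _◅_)
open import Relation.Binary.PropositionalEquality
open import Relation.Nullary using (¬_; Dec; yes; no; does; _×-dec_; contradiction)
open import Relation.Nullary.Decidable using (dec-true; dec-false)
open import Relation.Unary using (Pred; Decidable)

open import Algebra.Properties.Semiring.Sum (CommutativeRing.semiring xor-∧-commutativeRing)
  using (sum-syntax; sum-cong-≗; ∑-comm; *-distribˡ-sum; *-distribʳ-sum; ∑-distrib-+)

open ≡-Reasoning

private variable
  m n : ℕ

-- Subsets as truth tables

does-true⁻ : ∀ {a} {A : Set a} (A? : Dec A) → does A? ≡ true → A
does-true⁻ (yes a) _ = a

lookup-ext : (p q : Subset m) → (∀ i → lookup p i ≡ lookup q i) → p ≡ q
lookup-ext p q p≗q = begin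
  p                   ≡⟨ tabulate∘lookup p ⟨
  tabulate (lookup p) ≡⟨ tabulate-cong p≗q ⟩
  tabulate (lookup q) ≡⟨ tabulate∘lookup q ⟩
  q                   ∎

tabulate-⊥ : {f : Fin m → Bool} → (∀ i → f i ≡ false) → tabulate f ≡ ⊥
tabulate-⊥ {f = f} f≡false = lookup-ext (tabulate f) ⊥ λ i →
  trans (lookup∘tabulate f i) (trans (f≡false i) (sym (lookup-replicate i false)))

∈-tabulate⁺ : {f : Fin m → Bool} {i : Fin m} → f i ≡ true → i ∈ tabulate f
∈-tabulate⁺ {f = f} {i} fi = lookup⇒[]= i _ (trans (lookup∘tabulate f i) fi)

∈-tabulate⁻ : {f : Fin m → Bool} {i : Fin m} → i ∈ tabulate f → f i ≡ true
∈-tabulate⁻ {f = f} {i} i∈ = trans (sym (lookup∘tabulate f i)) ([]=⇒lookup i∈)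

∩-tabulate : (f g : Fin m → Bool) → tabulate f ∩ tabulate g ≡ tabulate (λ i → f i ∧ g i)
∩-tabulate {zero}  f g = refl
∩-tabulate {suc m} f g = cong ((f zero ∧ g zero) ∷_) (∩-tabulate (f ∘ suc) (g ∘ suc))

⊕-tabulate : (f g : Fin m → Bool) → tabulate f ⊕ tabulate g ≡ tabulate (λ i → f i xor g i)
⊕-tabulate {zero}  f g = refl
⊕-tabulate {suc m} f g = cong ((f zero xor g zero) ∷_) (⊕-tabulate (f ∘ suc) (g ∘ suc))

-- Subsets as vectors over ℤ₂, and their sizes

⊕-assoc : (p q r : Subset m) → (p ⊕ q) ⊕ r ≡ p ⊕ (q ⊕ r)
⊕-assoc = zipWith-assoc xor-assoc

⊕-identityˡ : (p : Subset m) → ⊥ ⊕ p ≡ p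
⊕-identityˡ = zipWith-identityˡ xor-identityˡ

⊕-identityʳ : (p : Subset m) → p ⊕ ⊥ ≡ p
⊕-identityʳ = zipWith-identityʳ xor-identityʳ

⊕-self : (p : Subset m) → p ⊕ p ≡ ⊥
⊕-self []      = refl
⊕-self (x ∷ p) = cong₂ _∷_ (xor-same x) (⊕-self p)

∩-distribʳ-⊕ : (r p q : Subset m) → (p ⊕ q) ∩ r ≡ (p ∩ r) ⊕ (q ∩ r)
∩-distribʳ-⊕ = zipWith-distribʳ ∧-distribʳ-xor

⊕-cancel-middle : (p q r : Subset m) → (p ⊕ q) ⊕ (q ⊕ r) ≡ p ⊕ r
⊕-cancel-middle p q r = begin
  (p ⊕ q) ⊕ (q ⊕ r) ≡⟨ ⊕-assoc p q (q ⊕ r) ⟩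
  p ⊕ (q ⊕ (q ⊕ r)) ≡⟨ cong (p ⊕_) (⊕-assoc q q r) ⟨
  p ⊕ ((q ⊕ q) ⊕ r) ≡⟨ cong (λ z → p ⊕ (z ⊕ r)) (⊕-self q) ⟩
  p ⊕ (⊥ ⊕ r)       ≡⟨ cong (p ⊕_) (⊕-identityˡ r) ⟩
  p ⊕ r             ∎

∣p∣≡1+∣p-x∣ : {p : Subset m} {x : Fin m} → x ∈ p → ∣ p ∣ ≡ suc ∣ p - x ∣
∣p∣≡1+∣p-x∣ {p = _ ∷ p} here = cong (λ q → suc ∣ q ∣) (sym (p─⊥≡p p))
∣p∣≡1+∣p-x∣ {p = inside  ∷ p} (there x∈) = cong suc (∣p∣≡1+∣p-x∣ x∈)
∣p∣≡1+∣p-x∣ {p = outside ∷ p} (there x∈) = ∣p∣≡1+∣p-x∣ x∈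

p≡⁅x⁆⊕[p-x] : {p : Subset m} {x : Fin m} → x ∈ p → p ≡ ⁅ x ⁆ ⊕ (p - x)
p≡⁅x⁆⊕[p-x] {p = _ ∷ p} here =
  cong (inside ∷_) (sym (trans (⊕-identityˡ _) (p─⊥≡p p)))
p≡⁅x⁆⊕[p-x] {p = inside  ∷ p} (there x∈) = cong (inside ∷_) (p≡⁅x⁆⊕[p-x] x∈)
p≡⁅x⁆⊕[p-x] {p = outside ∷ p} (there x∈) = cong (outside ∷_) (p≡⁅x⁆⊕[p-x] x∈)

p≡⁅x⁆⊕⁅y⁆⊕[p-x-y] : {p : Subset m} {x y : Fin m} → x ∈ p → y ∈ p - x →
  p ≡ (⁅ x ⁆ ⊕ ⁅ y ⁆) ⊕ (p - x - y)
p≡⁅x⁆⊕⁅y⁆⊕[p-x-y] {p = p} {x} {y} x∈ y∈ = begin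
  p                             ≡⟨ p≡⁅x⁆⊕[p-x] x∈ ⟩
  ⁅ x ⁆ ⊕ (p - x)               ≡⟨ cong (⁅ x ⁆ ⊕_) (p≡⁅x⁆⊕[p-x] y∈) ⟩
  ⁅ x ⁆ ⊕ (⁅ y ⁆ ⊕ (p - x - y)) ≡⟨ ⊕-assoc ⁅ x ⁆ ⁅ y ⁆ _ ⟨
  (⁅ x ⁆ ⊕ ⁅ y ⁆) ⊕ (p - x - y) ∎

∣p∣≡2+∣p-x-y∣ : {p : Subset m} {x y : Fin m} → x ∈ p → y ∈ p - x → ∣ p ∣ ≡ 2 + ∣ p - x - y ∣
∣p∣≡2+∣p-x-y∣ x∈ y∈ = trans (∣p∣≡1+∣p-x∣ x∈) (cong suc (∣p∣≡1+∣p-x∣ y∈))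

∣p∣≡0⇒p≡⊥ : (p : Subset m) → ∣ p ∣ ≡ 0 → p ≡ ⊥
∣p∣≡0⇒p≡⊥ p ∣p∣≡0 = Empty-unique λ (_ , x∈p) → contradiction (trans (sym (∣p∣≡1+∣p-x∣ x∈p)) ∣p∣≡0) λ ()

∣p∣≢0⇒Nonempty : (p : Subset m) → ∣ p ∣ ≢ 0 → Nonempty p
∣p∣≢0⇒Nonempty {m} p ∣p∣≢0 with nonempty? p
... | yes ne   = ne
... | no empty = contradiction (trans (cong ∣_∣ (Empty-unique empty)) (∣⊥∣≡0 m)) ∣p∣≢0

∣p∣≡suc⇒Nonempty : ∀ {k} (p : Subset m) → ∣ p ∣ ≡ suc k → Nonempty p
∣p∣≡suc⇒Nonempty p eq = ∣p∣≢0⇒Nonempty p λ ∣p∣≡0 → contradiction (trans (sym ∣p∣≡0) eq) λ ()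

x∉p-x : (p : Subset m) (x : Fin m) → x ∉ p - x
x∉p-x (_ ∷ p) (suc x) (there x∈) = x∉p-x p x x∈

∣p∪q∣≡∣p∣+∣q∣ : (p q : Subset m) → Empty (p ∩ q) → ∣ p ∪ q ∣ ≡ ∣ p ∣ + ∣ q ∣
∣p∪q∣≡∣p∣+∣q∣ []            []            _  = refl
∣p∪q∣≡∣p∣+∣q∣ (outside ∷ p) (outside ∷ q) ¬∩ = ∣p∪q∣≡∣p∣+∣q∣ p q (drop-∷-Empty ¬∩)
∣p∪q∣≡∣p∣+∣q∣ (outside ∷ p) (inside  ∷ q) ¬∩ =
  trans (cong suc (∣p∪q∣≡∣p∣+∣q∣ p q (drop-∷-Empty ¬∩))) (sym (+-suc ∣ p ∣ ∣ q ∣))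
∣p∪q∣≡∣p∣+∣q∣ (inside  ∷ p) (outside ∷ q) ¬∩ = cong suc (∣p∪q∣≡∣p∣+∣q∣ p q (drop-∷-Empty ¬∩))
∣p∪q∣≡∣p∣+∣q∣ (inside  ∷ p) (inside  ∷ q) ¬∩ = contradiction (zero , here) ¬∩

-- The intersection form

isOdd : ℕ → Bool
isOdd k = does (odd? k)

-- The standard bilinear form over ℤ₂: the size of the intersection mod 2.  By
-- definition the coefficient of σ in ∂ c is c · cofacets σ, and dually for δ.
infix 7 _·_

_·_ : Subset m → Subset m → Bool
p · q = isOdd ∣ p ∩ q ∣

isOdd-suc : ∀ k → isOdd (suc k) ≡ not (isOdd k)
isOdd-suc 0             = refl
isOdd-suc 1             = refl
isOdd-suc (suc (suc k)) = isOdd-suc k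

·-as-sum : (p q : Subset m) → p · q ≡ ∑[ i < m ] (lookup p i ∧ lookup q i)
·-as-sum []            []            = refl
·-as-sum (outside ∷ p) (_       ∷ q) = ·-as-sum p q
·-as-sum (inside  ∷ p) (outside ∷ q) = ·-as-sum p q
·-as-sum (inside  ∷ p) (inside  ∷ q) = trans (isOdd-suc ∣ p ∩ q ∣) (cong not (·-as-sum p q))

·-comm : (p q : Subset m) → p · q ≡ q · p
·-comm p q = cong (isOdd ∘ ∣_∣) (∩-comm p q)

Empty⇒·≡false : (p q : Subset m) → Empty (p ∩ q) → p · q ≡ false
Empty⇒·≡false {m} p q p∩q=∅ = cong isOdd (trans (cong ∣_∣ (Empty-unique p∩q=∅)) (∣⊥∣≡0 m))

·-zeroʳ : (p : Subset m) → p · ⊥ ≡ false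
·-zeroʳ p = Empty⇒·≡false p ⊥ (∉⊥ ∘ p∩q⊆q p ⊥ ∘ proj₂)

·-distribʳ-⊕ : (r p q : Subset m) → (p ⊕ q) · r ≡ (p · r) xor (q · r)
·-distribʳ-⊕ {m} r p q = begin
  (p ⊕ q) · r
    ≡⟨ ·-as-sum (p ⊕ q) r ⟩
  (∑[ i < m ] (lookup (p ⊕ q) i ∧ lookup r i))
    ≡⟨ sum-cong-≗ (λ i → trans (cong (_∧ lookup r i) (lookup-zipWith _xor_ i p q))
                               (∧-distribʳ-xor (lookup r i) (lookup p i) (lookup q i))) ⟩
  (∑[ i < m ] ((lookup p i ∧ lookup r i) xor (lookup q i ∧ lookup r i)))
    ≡⟨ ∑-distrib-+ (λ i → lookup p i ∧ lookup r i) (λ i → lookup q i ∧ lookup r i) ⟩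
  (∑[ i < m ] (lookup p i ∧ lookup r i)) xor (∑[ i < m ] (lookup q i ∧ lookup r i))
    ≡⟨ cong₂ _xor_ (·-as-sum p r) (·-as-sum q r) ⟨
  (p · r) xor (q · r) ∎

⁅x⁆·p≡lookup : (x : Fin m) (p : Subset m) → ⁅ x ⁆ · p ≡ lookup p x
⁅x⁆·p≡lookup zero    (outside ∷ p) = trans (·-comm ⊥ p) (·-zeroʳ p)
⁅x⁆·p≡lookup zero    (inside  ∷ p) = trans (isOdd-suc ∣ ⊥ ∩ p ∣) (cong not (trans (·-comm ⊥ p) (·-zeroʳ p)))
⁅x⁆·p≡lookup (suc x) (_ ∷ p) = ⁅x⁆·p≡lookup x p

-- A Boolean matrix M and its transpose act on subsets as ℤ₂-linear maps, which
-- are adjoint for the form _·_.  With M the incidence matrix of simplices and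
-- their facets these maps are ∂ and δ.
transpose-adjoint : (M : Fin m → Fin n → Bool) (p : Subset n) (q : Subset m) →
  tabulate (λ i → p · tabulate (λ j → M i j)) · q ≡
  p · tabulate (λ j → q · tabulate (λ i → M i j))
transpose-adjoint {m} {n} M p q = begin
  tabulate (λ i → p · tabulate (M i)) · q
    ≡⟨ ·-as-sum (tabulate λ i → p · tabulate (M i)) q ⟩
  (∑[ i < m ] (lookup (tabulate (λ i → p · tabulate (M i))) i ∧ lookup q i))
    ≡⟨ sum-cong-≗ (λ i → cong (_∧ lookup q i) (trans (lookup∘tabulate _ i) (expand p (M i)))) ⟩
  (∑[ i < m ] ((∑[ j < n ] (lookup p j ∧ M i j)) ∧ lookup q i))
    ≡⟨ sum-cong-≗ (λ i → *-distribʳ-sum (lookup q i) (λ j → lookup p j ∧ M i j)) ⟩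
  (∑[ i < m ] ∑[ j < n ] ((lookup p j ∧ M i j) ∧ lookup q i))
    ≡⟨ ∑-comm (λ i j → (lookup p j ∧ M i j) ∧ lookup q i) ⟩
  (∑[ j < n ] ∑[ i < m ] ((lookup p j ∧ M i j) ∧ lookup q i))
    ≡⟨ sum-cong-≗ (λ j → sum-cong-≗ (λ i → trans (∧-assoc (lookup p j) (M i j) (lookup q i))
                                             (cong (lookup p j ∧_) (∧-comm (M i j) (lookup q i))))) ⟩
  (∑[ j < n ] ∑[ i < m ] (lookup p j ∧ (lookup q i ∧ M i j)))
    ≡⟨ sum-cong-≗ (λ j → *-distribˡ-sum (lookup p j) (λ i → lookup q i ∧ M i j)) ⟨
  (∑[ j < n ] (lookup p j ∧ (∑[ i < m ] (lookup q i ∧ M i j))))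
    ≡⟨ sum-cong-≗ (λ j → cong (lookup p j ∧_)
         (trans (lookup∘tabulate _ j) (expand q (λ i → M i j)))) ⟨
  (∑[ j < n ] (lookup p j ∧ lookup (tabulate (λ j → q · tabulate (λ i → M i j))) j))
    ≡⟨ ·-as-sum p _ ⟨
  p · tabulate (λ j → q · tabulate (λ i → M i j)) ∎
  where
  expand : ∀ {k} (r : Subset k) (f : Fin k → Bool) → r · tabulate f ≡ ∑[ i < k ] (lookup r i ∧ f i)
  expand r f = trans (·-as-sum r _) (sum-cong-≗ λ i → cong (lookup r i ∧_) (lookup∘tabulate f i))

-- Counting the subsets of given size in an interval

length-filter-map : ∀ {a b} {A : Set a} {B : Set b} {P : Pred B 0ℓ} (P? : Decidable P) (f : A → B) xs →
  length (filter P? (List.map f xs)) ≡ length (filter (P? ∘ f) xs)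
length-filter-map P? f []       = refl
length-filter-map P? f (x ∷ xs) with does (P? (f x))
... | true  = cong suc (length-filter-map P? f xs)
... | false = length-filter-map P? f xs

filter-filter : {A : Set} {P Q : Pred A 0ℓ} (P? : Decidable P) (Q? : Decidable Q) (xs : List A) →
  filter Q? (filter P? xs) ≡ filter (λ x → P? x ×-dec Q? x) xs
filter-filter P? Q? []       = refl
filter-filter P? Q? (x ∷ xs) with does (P? x)
... | false = filter-filter P? Q? xs
... | true with does (Q? x)
...   | true  = cong (x ∷_) (filter-filter P? Q? xs)
...   | false = filter-filter P? Q? xs

∣tabulate∣ : {A : Set} {P : Pred A 0ℓ} (P? : Decidable P) (xs : List A) →
  ∣ tabulate (λ i → does (P? (List.lookup xs i))) ∣ ≡ length (filter P? xs)
∣tabulate∣ P? []       = refl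
∣tabulate∣ P? (x ∷ xs) with does (P? x)
... | true  = cong suc (∣tabulate∣ P? xs)
... | false = ∣tabulate∣ P? xs

-- ρ lies between σ and τ and has k elements.
Between : Subset n → Subset n → ℕ → Pred (Subset n) 0ℓ
Between σ τ k ρ = ∣ ρ ∣ ≡ k × σ ⊆ ρ × ρ ⊆ τ

between? : (σ τ : Subset n) (k : ℕ) → Decidable (Between σ τ k)
between? σ τ k ρ = (∣ ρ ∣ ≟ℕ k) ×-dec (σ ⊆? ρ) ×-dec (ρ ⊆? τ)

in⊈out : {p q : Subset n} → ¬ (inside ∷ p ⊆ outside ∷ q)
in⊈out p⊆q with () ← p⊆q here

-- A subset of Fin (suc n) is counted according to whether it contains zero.
count-cons : {P : Pred (Subset (suc n)) 0ℓ} (P? : Decidable P) {a b : ℕ} →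
  length (filter (P? ∘ (outside ∷_)) (subsets n)) ≡ a →
  length (filter (P? ∘ (inside ∷_)) (subsets n)) ≡ b →
  length (filter P? (subsets (suc n))) ≡ a + b
count-cons {n} P? {a} {b} eqa eqb = begin
  length (filter P? (out ++ ins))               ≡⟨ cong length (filter-++ P? out ins) ⟩
  length (filter P? out ++ filter P? ins)       ≡⟨ length-++ (filter P? out) ⟩
  length (filter P? out) + length (filter P? ins)
    ≡⟨ cong₂ _+_ (trans (length-filter-map P? (outside ∷_) (subsets n)) eqa)
                 (trans (length-filter-map P? (inside ∷_) (subsets n)) eqb) ⟩
  a + b ∎
  where
  out = List.map (outside ∷_) (subsets n)
  ins = List.map (inside ∷_) (subsets n)

count-≐ : {P Q : Pred (Subset n) 0ℓ} (P? : Decidable P) (Q? : Decidable Q) {a : ℕ} →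
  (∀ {ρ} → P ρ → Q ρ) → (∀ {ρ} → Q ρ → P ρ) →
  length (filter Q? (subsets n)) ≡ a → length (filter P? (subsets n)) ≡ a
count-≐ P? Q? to from eq = trans (cong length (filter-≐ P? Q? (to , from) (subsets _))) eq

count-none : {P : Pred (Subset n) 0ℓ} (P? : Decidable P) → (∀ {ρ} → ¬ P ρ) →
  length (filter P? (subsets n)) ≡ 0
count-none P? ¬P = cong length (filter-none P? (All.universal (λ _ → ¬P) (subsets _)))

-- If τ has a more elements than σ, then choosing a set of size b + ∣ σ ∣ between
-- them amounts to choosing b of the a elements of τ outside σ.
count-between : (σ τ : Subset n) (a b : ℕ) → σ ⊆ τ → ∣ τ ∣ ≡ a + ∣ σ ∣ →
  length (filter (between? σ τ (b + ∣ σ ∣)) (subsets n)) ≡ a C b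
count-between [] [] zero zero σ⊆τ eq = refl
count-between [] [] zero (suc b) σ⊆τ eq = refl
count-between {suc n} (outside ∷ σ) (outside ∷ τ) a b σ⊆τ eq =
  trans (count-cons P?
    (count-≐ (P? ∘ (outside ∷_)) (between? σ τ _)
      (λ (s , l , u) → s , drop-∷-⊆ l , drop-∷-⊆ u) (λ (s , l , u) → s , out⊆ l , out⊆ u)
      (count-between σ τ a b (drop-∷-⊆ σ⊆τ) eq))
    (count-none (P? ∘ (inside ∷_)) λ (_ , _ , u) → in⊈out u))
  (+-identityʳ _)
  where P? = between? (outside ∷ σ) (outside ∷ τ) (b + ∣ σ ∣)
count-between (inside ∷ σ) (outside ∷ τ) a b σ⊆τ eq = contradiction (λ {x} → σ⊆τ {x}) in⊈out
count-between (inside ∷ σ) (inside ∷ τ) a b σ⊆τ eq =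
  count-cons P?
    (count-none (P? ∘ (outside ∷_)) λ (_ , l , _) → in⊈out l)
    (count-≐ (P? ∘ (inside ∷_)) (between? σ τ _)
      (λ (s , l , u) → suc-injective (trans s (+-suc b ∣ σ ∣)) , drop-∷-⊆ l , drop-∷-⊆ u)
      (λ (s , l , u) → trans (cong suc s) (sym (+-suc b ∣ σ ∣)) , in⊆in l , in⊆in u)
      (count-between σ τ a b (drop-∷-⊆ σ⊆τ) (suc-injective (trans eq (+-suc a ∣ σ ∣)))))
  where P? = between? (inside ∷ σ) (inside ∷ τ) (b + suc ∣ σ ∣)
-- In the remaining clauses zero lies in τ but not in σ, so a is positive and
-- Pascal's rule applies, according to whether zero is among the chosen elements.
count-between (outside ∷ σ) (inside ∷ τ) zero b σ⊆τ eq =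
  contradiction (subst (_≤ ∣ τ ∣) (sym eq) (p⊆q⇒∣p∣≤∣q∣ (drop-∷-⊆ σ⊆τ))) 1+n≰n
count-between (outside ∷ σ) (inside ∷ τ) (suc a) zero σ⊆τ eq =
  count-cons P?
    (count-≐ (P? ∘ (outside ∷_)) (between? σ τ _)
      (λ (s , l , u) → s , drop-∷-⊆ l , drop-∷-⊆ u) (λ (s , l , u) → s , out⊆ l , out⊆ u)
      (count-between σ τ a zero (drop-∷-⊆ σ⊆τ) (suc-injective eq)))
    (count-none (P? ∘ (inside ∷_)) λ {ρ} (s , l , _) →
      1+n≰n (subst (_≤ ∣ ρ ∣) (sym s) (p⊆q⇒∣p∣≤∣q∣ (drop-∷-⊆ l))))
  where P? = between? (outside ∷ σ) (inside ∷ τ) ∣ σ ∣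
count-between (outside ∷ σ) (inside ∷ τ) (suc a) (suc b) σ⊆τ eq =
  trans (count-cons P?
    (count-≐ (P? ∘ (outside ∷_)) (between? σ τ _)
      (λ (s , l , u) → s , drop-∷-⊆ l , drop-∷-⊆ u) (λ (s , l , u) → s , out⊆ l , out⊆ u)
      (count-between σ τ a (suc b) (drop-∷-⊆ σ⊆τ) (suc-injective eq)))
    (count-≐ (P? ∘ (inside ∷_)) (between? σ τ _)
      (λ (s , l , u) → suc-injective s , drop-∷-⊆ l , drop-∷-⊆ u)
      (λ (s , l , u) → cong suc s , out⊆ l , in⊆in u)
      (count-between σ τ a b (drop-∷-⊆ σ⊆τ) (suc-injective eq))))
  (trans (+-comm (a C suc b) (a C b)) (nCk+nC[k+1]≡[n+1]C[k+1] a b))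
  where P? = between? (outside ∷ σ) (inside ∷ τ) (suc b + ∣ σ ∣)

-- Simplices, facets and cofacets

∈-subsets : (σ : Subset n) → σ ∈ᴸ subsets n
∈-subsets []            = here refl
∈-subsets {suc n} (outside ∷ σ) = ∈-++⁺ˡ (∈-map⁺ (outside ∷_) (∈-subsets σ))
∈-subsets {suc n} (inside  ∷ σ) =
  ∈-++⁺ʳ (List.map (outside ∷_) (subsets n)) (∈-map⁺ (inside ∷_) (∈-subsets σ))

subsets-unique : ∀ n → Unique (subsets n)
subsets-unique zero    = All.[] ∷ []
subsets-unique (suc n) = Uniqueₚ.++⁺
  (Uniqueₚ.map⁺ (proj₂ ∘ ∷-injective) (subsets-unique n))
  (Uniqueₚ.map⁺ (proj₂ ∘ ∷-injective) (subsets-unique n))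
  λ (∈out , ∈in) → let (_ , _ , eq)  = ∈-map⁻ (outside ∷_) ∈out
                       (_ , _ , eq′) = ∈-map⁻ (inside ∷_) ∈in
                   in contradiction (trans (sym eq) eq′) λ ()

lookup-injective : {A : Set} {xs : List A} → Unique xs →
  ∀ i j → List.lookup xs i ≡ List.lookup xs j → i ≡ j
lookup-injective (_   ∷ _) zero    zero    eq = refl
lookup-injective (x∉ ∷ _) zero    (suc j) eq = contradiction eq (All.lookup x∉ (∈-lookup j))
lookup-injective (x∉ ∷ _) (suc i) zero    eq = contradiction (sym eq) (All.lookup x∉ (∈-lookup i))
lookup-injective (_   ∷ u) (suc i) (suc j) eq = cong suc (lookup-injective u i j eq)

module _ {n : ℕ} (K : SimplicialComplex n) where
  open SimplicialComplex K

  module _ (p : ℕ) where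
    private
      IsSimplex? : Decidable λ σ → Face σ × ∣ σ ∣ ≡ suc p
      IsSimplex? σ = Face? σ ×-dec (∣ σ ∣ ≟ℕ suc p)

    vertices-isSimplex : ∀ s → Face (vertices K {p} s) × ∣ vertices K {p} s ∣ ≡ suc p
    vertices-isSimplex s = proj₂ (∈-filter⁻ IsSimplex? {xs = subsets n} (∈-lookup s))

    simplexOn : ∀ {σ} → Face σ → ∣ σ ∣ ≡ suc p → ∃[ s ] vertices K {p} s ≡ σ
    simplexOn {σ} face size = Any.index σ∈ , sym (lookup-index σ∈)
      where σ∈ = ∈-filter⁺ IsSimplex? (∈-subsets σ) (face , size)

    vertices-injective : ∀ s t → vertices K {p} s ≡ vertices K {p} t → s ≡ t
    vertices-injective = lookup-injective (Uniqueₚ.filter⁺ IsSimplex? (subsets-unique n))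

    -- Every set of suc p elements inside the face τ is itself a face, so the
    -- p-simplices between σ and τ are all the sets of that size between them.
    count-simplices-between : ∀ {σ τ} a b → Face τ → σ ⊆ τ →
      ∣ τ ∣ ≡ a + ∣ σ ∣ → suc p ≡ b + ∣ σ ∣ →
      ∣ tabulate (λ (s : Simplex K p) → does (σ ⊆? vertices K {p} s) ∧ does (vertices K {p} s ⊆? τ)) ∣
        ≡ a C b
    count-simplices-between {σ} {τ} a b faceτ σ⊆τ size size′ = begin
      ∣ tabulate (λ (s : Simplex K p) → does (σ ⊆? vertices K {p} s) ∧ does (vertices K {p} s ⊆? τ)) ∣
        ≡⟨ ∣tabulate∣ Q? (simplices K p) ⟩
      length (filter Q? (simplices K p))
        ≡⟨ cong length (filter-filter IsSimplex? Q? (subsets n)) ⟩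
      length (filter (λ ρ → IsSimplex? ρ ×-dec Q? ρ) (subsets n))
        ≡⟨ count-≐ _ (between? σ τ (b + ∣ σ ∣))
             (λ ((_ , k) , l , u) → trans k size′ , l , u)
             (λ {ρ} (k , l , u) → (face (trans k (sym size′)) (λ {x} → u {x}) , trans k (sym size′)) , l , u)
             (count-between σ τ a b σ⊆τ size) ⟩
      a C b ∎
      where
      Q? : Decidable λ ρ → σ ⊆ ρ × ρ ⊆ τ
      Q? ρ = (σ ⊆? ρ) ×-dec (ρ ⊆? τ)

      face : ∀ {ρ} → ∣ ρ ∣ ≡ suc p → ρ ⊆ τ → Face ρ
      face {ρ} size ρ⊆τ = down-closed faceτ (∣p∣≡suc⇒Nonempty ρ size) ρ⊆τ

  ∣facets∣ : ∀ p τ → ∣ facets K p τ ∣ ≡ suc (suc p) C suc p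
  ∣facets∣ p τ = trans
    (cong ∣_∣ (tabulate-cong λ s → cong (_∧ does (vertices K {p} s ⊆? vertices K {suc p} τ))
                                   (sym (dec-true (⊥ ⊆? vertices K {p} s) ⊥⊆))))
    (count-simplices-between p {⊥} (suc (suc p)) (suc p) (proj₁ simplexτ) ⊥⊆
      (trans (proj₂ simplexτ) (sym (size-⊥ _))) (sym (size-⊥ _)))
    where
    simplexτ = vertices-isSimplex (suc p) τ
    size-⊥ : ∀ k → k + ∣ ⊥ {n} ∣ ≡ k
    size-⊥ k = trans (cong (k +_) (∣⊥∣≡0 n)) (+-identityʳ k)

  -- If σ is a face of τ of codimension 2, exactly 2 C 1 ≡ 2 simplices lie
  -- strictly between them; otherwise there are none.
  cofacets·facets : ∀ p σ τ → cofacets K p σ · facets K (suc p) τ ≡ false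
  cofacets·facets p σ τ with vertices K {p} σ ⊆? vertices K {suc (suc p)} τ
  ... | yes σ⊆τ = cong isOdd (trans
    (cong ∣_∣ (∩-tabulate (λ e → does (vertices K {p} σ ⊆? vertices K {suc p} e))
                          (λ e → does (vertices K {suc p} e ⊆? vertices K {suc (suc p)} τ))))
    (count-simplices-between (suc p) 2 1 (proj₁ simplexτ) σ⊆τ
      (trans (proj₂ simplexτ) (cong (λ k → suc (suc k)) (sym sizeσ))) (cong suc (sym sizeσ))))
    where
    simplexτ = vertices-isSimplex (suc (suc p)) τ
    sizeσ    = proj₂ (vertices-isSimplex p σ)
  ... | no σ⊈τ = Empty⇒·≡false (cofacets K p σ) (facets K (suc p) τ) empty
    where
    empty : Empty (cofacets K p σ ∩ facets K (suc p) τ)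
    empty (e , e∈) = let (e∈σ , e∈τ) = x∈p∩q⁻ (cofacets K p σ) _ e∈ in
      σ⊈τ (⊆-trans (does-true⁻ (_ ⊆? _) (∈-tabulate⁻ e∈σ)) (does-true⁻ (_ ⊆? _) (∈-tabulate⁻ e∈τ)))

  ∂-⊕ : ∀ p (c d : Chain K (suc p)) → ∂ K p (c ⊕ d) ≡ ∂ K p c ⊕ ∂ K p d
  ∂-⊕ p c d = trans (tabulate-cong λ σ → ·-distribʳ-⊕ (cofacets K p σ) c d)
                    (sym (⊕-tabulate (λ σ → c · cofacets K p σ) (λ σ → d · cofacets K p σ)))

  ∂-δ-adjoint : ∀ p (c : Chain K (suc p)) (η : Cochain K p) → ∂ K p c · η ≡ c · δ K p η
  ∂-δ-adjoint p = transpose-adjoint λ σ τ → does (vertices K {p} σ ⊆? vertices K {suc p} τ)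

  -- By adjointness the coefficient of σ in ∂ (∂ c) is c paired with the
  -- coboundary of cofacets σ = δ ⁅ σ ⁆, and that coboundary vanishes.
  ∂∂≡⊥ : ∀ p (c : Chain K (suc (suc p))) → ∂ K p (∂ K (suc p) c) ≡ ⊥
  ∂∂≡⊥ p c = tabulate-⊥ λ σ → begin
    ∂ K (suc p) c · cofacets K p σ   ≡⟨ ∂-δ-adjoint (suc p) c (cofacets K p σ) ⟩
    c · δ K (suc p) (cofacets K p σ) ≡⟨ cong (c ·_) (tabulate-⊥ λ τ → cofacets·facets p σ τ) ⟩
    c · ⊥                            ≡⟨ ·-zeroʳ c ⟩
    false                            ∎

  ∂⊥≡⊥ : ∀ p → ∂ K p ⊥ ≡ ⊥
  ∂⊥≡⊥ p = tabulate-⊥ λ σ → trans (·-comm ⊥ (cofacets K p σ)) (·-zeroʳ (cofacets K p σ))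

  ∂⁅τ⁆≡facets : ∀ p τ → ∂ K p ⁅ τ ⁆ ≡ facets K p τ
  ∂⁅τ⁆≡facets p τ = tabulate-cong λ σ →
    trans (⁅x⁆·p≡lookup τ (cofacets K p σ)) (lookup∘tabulate _ τ)

  ∈-cofacets⁺ : ∀ p σ τ → vertices K {p} σ ⊆ vertices K {suc p} τ → τ ∈ cofacets K p σ
  ∈-cofacets⁺ p σ τ σ⊆τ = ∈-tabulate⁺ (dec-true (vertices K {p} σ ⊆? vertices K {suc p} τ) σ⊆τ)

  ∈cofacets⇒∈facets : ∀ p {σ τ} → τ ∈ cofacets K p σ → σ ∈ facets K p τ
  ∈cofacets⇒∈facets p τ∈ = ∈-tabulate⁺ (∈-tabulate⁻ τ∈)

-- Edges of a closed surface

∪-cancelˡ-⊆ : {p q r : Subset m} → Empty (p ∩ q) → p ∪ q ≡ p ∪ r → q ⊆ r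
∪-cancelˡ-⊆ {p = p} {q} {r} p∩q=∅ eq {x} x∈q
  with x∈p∪q⁻ p r (subst (x ∈_) eq (x∈p∪q⁺ (inj₂ x∈q)))
... | inj₁ x∈p = contradiction (x , x∈p∩q⁺ (x∈p , x∈q)) p∩q=∅
... | inj₂ x∈r = x∈r

p∩[q─p]-empty : (p q : Subset m) → Empty (p ∩ (q ─ p))
p∩[q─p]-empty (_       ∷ p) (_ ∷ q)       (suc x , there x∈) = p∩[q─p]-empty p q (x , x∈)
p∩[q─p]-empty (outside ∷ p) (_ ∷ q)       (zero , ())
p∩[q─p]-empty (inside  ∷ p) (outside ∷ q) (zero , ())
p∩[q─p]-empty (inside  ∷ p) (inside  ∷ q) (zero , ())

p∪[q─p]≡q : {p q : Subset m} → p ⊆ q → p ∪ (q ─ p) ≡ q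
p∪[q─p]≡q {p = []}          {[]}          _   = refl
p∪[q─p]≡q {p = outside ∷ p} {_ ∷ q}       p⊆q = cong (_ ∷_) (p∪[q─p]≡q (drop-∷-⊆ p⊆q))
p∪[q─p]≡q {p = inside  ∷ p} {inside  ∷ q} p⊆q = cong (inside ∷_) (p∪[q─p]≡q (drop-∷-⊆ p⊆q))
p∪[q─p]≡q {p = inside  ∷ p} {outside ∷ q} p⊆q = contradiction (λ {x} → p⊆q {x}) in⊈out

⁅x⁆⊆p : ∀ {x} {p : Subset m} → x ∈ p → ⁅ x ⁆ ⊆ p
⁅x⁆⊆p {x = x} x∈p y∈ = subst (_∈ _) (sym (x∈⁅y⁆⇒x≡y x y∈)) x∈p

two-elements : (p : Subset m) → ∣ p ∣ ≡ 2 → ∃₂ λ x y → x ≢ y × x ∈ p × y ∈ p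
two-elements p ∣p∣≡2 =
  let (x , x∈p)   = ∣p∣≡suc⇒Nonempty p ∣p∣≡2
      ∣p-x∣≡1     = suc-injective (trans (sym (∣p∣≡1+∣p-x∣ x∈p)) ∣p∣≡2)
      (y , y∈p-x) = ∣p∣≡suc⇒Nonempty (p - x) ∣p-x∣≡1
  in x , y , (λ x≡y → x∉p-x p x (subst (_∈ p - x) (sym x≡y) y∈p-x)) , x∈p , p─q⊆p p ⁅ x ⁆ y∈p-x

module _ {n : ℕ} (K : SimplicialComplex n) where
  open SimplicialComplex K

  module _ (v : Simplex K 0) where
    private
      V = vertices K {0} v
      L = Link K V

    -- The triangle spanned by v and an edge of its link.
    cone : (f : Simplex L 1) → ∃[ s ] vertices K {2} s ≡ V ∪ vertices L {1} f
    cone f =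
      let ((_ , disjoint , face) , size) = vertices-isSimplex L 1 f
      in simplexOn K 2 face (trans (∣p∪q∣≡∣p∣+∣q∣ V _ disjoint)
                                   (cong₂ _+_ (proj₂ (vertices-isSimplex K 0 v)) size))

    cone-injective : ∀ f g → proj₁ (cone f) ≡ proj₁ (cone g) → f ≡ g
    cone-injective f g eq =
      let ((_ , disjointf , _) , _) = vertices-isSimplex L 1 f
          ((_ , disjointg , _) , _) = vertices-isSimplex L 1 g
          V∪f≡V∪g = trans (sym (proj₂ (cone f))) (trans (cong (vertices K {2}) eq) (proj₂ (cone g)))
      in vertices-injective L 1 f g
           (⊆-antisym (∪-cancelˡ-⊆ disjointf V∪f≡V∪g) (∪-cancelˡ-⊆ disjointg (sym V∪f≡V∪g)))

    -- An edge V ∪ ω at v lies in the cones over the two link edges at ω.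
    two-triangles : IsCircle L → ∀ {ω} → Empty (V ∩ ω) → Face (V ∪ ω) → ∣ ω ∣ ≡ 1 →
      ∃₂ λ s t → s ≢ t × V ∪ ω ⊆ vertices K {2} s × V ∪ ω ⊆ vertices K {2} t
    two-triangles circle {ω} disjoint face size =
      let nonempty-ω   = ∣p∣≡suc⇒Nonempty ω size
          (w , w≡ω)    = simplexOn L 0 (nonempty-ω , disjoint , face) size
          (f , g , f≢g , f∈ , g∈) = two-elements (cofacets L 0 w) (IsCircle.degree circle w)
      in proj₁ (cone f) , proj₁ (cone g) , f≢g ∘ cone-injective f g , below w≡ω f f∈ , below w≡ω g g∈
      where
      below : ∀ {w} → vertices L {0} w ≡ ω → ∀ f → f ∈ cofacets L 0 w →
              V ∪ ω ⊆ vertices K {2} (proj₁ (cone f))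
      below {w} refl f f∈ {x} x∈ = subst (x ∈_) (sym (proj₂ (cone f)))
        (x∈p∪q⁺ (map₂ (does-true⁻ (vertices L {0} w ⊆? vertices L {1} f) (∈-tabulate⁻ f∈)) (x∈p∪q⁻ V ω x∈)))

  -- Any edge is an endpoint v together with the singleton ω of the other one.
  edge≡vertex∪singleton : (e : Simplex K 1) → ∃₂ λ (v : Simplex K 0) ω →
    Empty (vertices K {0} v ∩ ω) × ∣ ω ∣ ≡ 1 × vertices K {0} v ∪ ω ≡ vertices K {1} e
  edge≡vertex∪singleton e
    with (face , size) ← vertices-isSimplex K 1 e
    with (x , x∈E) ← ∣p∣≡suc⇒Nonempty (vertices K {1} e) size
    with (v , V≡⁅x⁆) ← simplexOn K 0 (down-closed face (x , x∈⁅x⁆ x) (⁅x⁆⊆p x∈E)) (∣⁅x⁆∣≡1 x)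
    = v , E ─ V , disjoint , suc-injective (begin
        1 + ∣ E ─ V ∣     ≡⟨ cong (_+ ∣ E ─ V ∣) (proj₂ (vertices-isSimplex K 0 v)) ⟨
        ∣ V ∣ + ∣ E ─ V ∣ ≡⟨ ∣p∪q∣≡∣p∣+∣q∣ V (E ─ V) disjoint ⟨
        ∣ V ∪ (E ─ V) ∣   ≡⟨ cong ∣_∣ V∪[E─V]≡E ⟩
        ∣ E ∣             ≡⟨ size ⟩
        2                 ∎) , V∪[E─V]≡E
    where
    E = vertices K {1} e
    V = vertices K {0} v
    disjoint  = p∩[q─p]-empty V E
    V∪[E─V]≡E = p∪[q─p]≡q (subst (_⊆ E) (sym V≡⁅x⁆) (⁅x⁆⊆p x∈E))

  -- So every edge of a closed surface is an honest edge of the dual graph, whose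
  -- joined nodes are required to be distinct.
  edge-in-two-triangles : IsClosedSurface K → (e : Simplex K 1) →
    ∃₂ λ s t → Graph.Joins (dualGraph K) e s t
  edge-in-two-triangles surface e =
    let (v , ω , disjoint , size , V∪ω≡E) = edge≡vertex∪singleton e in cofaces v ω disjoint size V∪ω≡E
    where
    cofaces : (v : Simplex K 0) (ω : Subset n) → Empty (vertices K {0} v ∩ ω) → ∣ ω ∣ ≡ 1 →
      vertices K {0} v ∪ ω ≡ vertices K {1} e → ∃₂ λ s t → Graph.Joins (dualGraph K) e s t
    cofaces v ω disjoint size V∪ω≡E =
      let (s , t , s≢t , ⊆s , ⊆t) = two-triangles v (surface v) disjoint
             (subst Face (sym V∪ω≡E) (proj₁ (vertices-isSimplex K 1 e))) size
      in s , t , s≢t , incident s ⊆s , incident t ⊆t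
      where
      incident : ∀ u → vertices K {0} v ∪ ω ⊆ vertices K {2} u → u ∈ cofacets K 1 e
      incident u ⊆u = ∈-cofacets⁺ K 1 e u (⊆-trans (⊆-reflexive (sym V∪ω≡E)) ⊆u)

-- Moving along a connected cocycle

module _ {n : ℕ} (K : SimplicialComplex n) (η : Cochain K 1) where

  -- X is cut out on η by some boundary.  These X form a subspace.
  Trace : Chain K 1 → Set
  Trace X = ∃[ c ] ∂ K 1 c ∩ η ≡ X

  trace-⊥ : Trace ⊥
  trace-⊥ = ⊥ , trans (cong (_∩ η) (∂⊥≡⊥ K 1)) (∩-zeroˡ η)

  trace-⊕ : ∀ {X Y} → Trace X → Trace Y → Trace (X ⊕ Y)
  trace-⊕ {X} {Y} (c , c↦X) (d , d↦Y) = c ⊕ d , (begin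
    ∂ K 1 (c ⊕ d) ∩ η               ≡⟨ cong (_∩ η) (∂-⊕ K 1 c d) ⟩
    (∂ K 1 c ⊕ ∂ K 1 d) ∩ η         ≡⟨ ∩-distribʳ-⊕ η _ _ ⟩
    (∂ K 1 c ∩ η) ⊕ (∂ K 1 d ∩ η)   ≡⟨ cong₂ _⊕_ c↦X d↦Y ⟩
    X ⊕ Y                           ∎)

  module _ (cocycle : Is1Cocycle K η) where

    -- Two distinct edges e and e′ of η in the triangle t are the only edges of
    -- η in t: η meets t in an even number of its three edges.  Hence the
    -- boundary of t meets η exactly in e and e′.
    trace-triangle : ∀ {t e e′} → e ∈ facets K 1 t → e ∈ η → e′ ∈ facets K 1 t → e′ ∈ η →
                     Trace (⁅ e ⁆ ⊕ ⁅ e′ ⁆)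
    trace-triangle {t} {e} {e′} e∈t e∈η e′∈t e′∈η with e ≟ᶠ e′
    ... | yes refl = subst Trace (sym (⊕-self ⁅ e ⁆)) trace-⊥
    ... | no e≢e′  = ⁅ t ⁆ , (begin
      ∂ K 1 ⁅ t ⁆ ∩ η                 ≡⟨ cong (_∩ η) (∂⁅τ⁆≡facets K 1 t) ⟩
      X                               ≡⟨ p≡⁅x⁆⊕⁅y⁆⊕[p-x-y] e∈X e′∈X-e ⟩
      (⁅ e ⁆ ⊕ ⁅ e′ ⁆) ⊕ (X - e - e′) ≡⟨ cong ((⁅ e ⁆ ⊕ ⁅ e′ ⁆) ⊕_) (∣p∣≡0⇒p≡⊥ _ rest-empty) ⟩
      (⁅ e ⁆ ⊕ ⁅ e′ ⁆) ⊕ ⊥            ≡⟨ ⊕-identityʳ _ ⟩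
      ⁅ e ⁆ ⊕ ⁅ e′ ⁆                  ∎)
      where
      X      = facets K 1 t ∩ η
      e∈X    = x∈p∩q⁺ (e∈t , e∈η)
      e′∈X-e = x∈p∧x≢y⇒x∈p-y (x∈p∩q⁺ (e′∈t , e′∈η)) (e≢e′ ∘ sym)

      even : facets K 1 t · η ≡ false
      even = begin
        facets K 1 t · η   ≡⟨ ·-comm (facets K 1 t) η ⟩
        η · facets K 1 t   ≡⟨ lookup∘tabulate (λ τ → η · facets K 1 τ) t ⟨
        lookup (δ K 1 η) t ≡⟨ cong (λ p → lookup p t) cocycle ⟩
        lookup ⊥ t         ≡⟨ lookup-replicate t false ⟩
        false              ∎

      even-≤1 : ∀ {k} → k ≤ 1 → isOdd k ≡ false → k ≡ 0
      even-≤1 z≤n       _ = refl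
      even-≤1 (s≤s z≤n) ()

      ∣X∣≡ : ∣ X ∣ ≡ 2 + ∣ X - e - e′ ∣
      ∣X∣≡ = ∣p∣≡2+∣p-x-y∣ e∈X e′∈X-e

      -- The bound 3 C 2 on the size of X evaluates to 3.
      rest-empty : ∣ X - e - e′ ∣ ≡ 0
      rest-empty = even-≤1
        (s≤s⁻¹ (s≤s⁻¹ (subst₂ _≤_ ∣X∣≡ (∣facets∣ K 1 t) (∣p∩q∣≤∣p∣ (facets K 1 t) η))))
        (trans (cong isOdd (sym ∣X∣≡)) even)

    -- Sum over the triangles of a path in the dual graph along η: each edge
    -- crossed by the path occurs twice and cancels.
    trace-path : ∀ {s t} → Star (AdjacentVia (dualGraph K) (_∈ η)) s t →
      ∀ {e e′} → e ∈ facets K 1 s → e ∈ η → e′ ∈ facets K 1 t → e′ ∈ η → Trace (⁅ e ⁆ ⊕ ⁅ e′ ⁆)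
    trace-path ε = trace-triangle
    trace-path ((f , f∈η , _ , s∈f , u∈f) ◅ path) {e} {e′} e∈s e∈η e′∈t e′∈η =
      subst Trace (⊕-cancel-middle ⁅ e ⁆ ⁅ f ⁆ ⁅ e′ ⁆) (trace-⊕
        (trace-triangle e∈s e∈η (∈cofacets⇒∈facets K 1 s∈f) f∈η)
        (trace-path path (∈cofacets⇒∈facets K 1 u∈f) f∈η e′∈t e′∈η))

  trace-pair : IsClosedSurface K → ConnectedCocycle K η →
    ∀ {e e′} → e ∈ η → e′ ∈ η → Trace (⁅ e ⁆ ⊕ ⁅ e′ ⁆)
  trace-pair surface (cocycle , connected) {e} {e′} e∈η e′∈η =
    let (s , s′ , joins@(_ , s∈e , _))  = edge-in-two-triangles K surface e
        (t , t′ , joins′@(_ , t∈e′ , _)) = edge-in-two-triangles K surface e′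
    in trace-path cocycle (connected (e , e∈η , joins) (e′ , e′∈η , joins′))
         (∈cofacets⇒∈facets K 1 s∈e) e∈η (∈cofacets⇒∈facets K 1 t∈e′) e′∈η

  -- Split X into pairs of edges.
  trace-even : IsClosedSurface K → ConnectedCocycle K η →
    ∀ {X} → X ⊆ η → isOdd ∣ X ∣ ≡ false → Trace X
  trace-even surface connected {X} = go X (⊂-wellFounded X)
    where
    go : ∀ X → Acc _⊂_ X → X ⊆ η → isOdd ∣ X ∣ ≡ false → Trace X
    go X (acc rec) X⊆η even with nonempty? X
    ... | no empty = subst Trace (sym (Empty-unique empty)) trace-⊥
    ... | yes (e , e∈X) = subst Trace (sym (p≡⁅x⁆⊕⁅y⁆⊕[p-x-y] e∈X e′∈X-e)) (trace-⊕
      (trace-pair surface connected (X⊆η e∈X) (X⊆η (p─q⊆p X ⁅ e ⁆ e′∈X-e)))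
      (go (X - e - e′) (rec (⊂-trans (x∈p⇒p-x⊂p e′∈X-e) (x∈p⇒p-x⊂p e∈X)))
        (⊆-trans (p─q⊆p (X - e) ⁅ e′ ⁆) (⊆-trans (p─q⊆p X ⁅ e ⁆) X⊆η))
        (trans (cong isOdd (sym (∣p∣≡2+∣p-x-y∣ e∈X e′∈X-e))) even)))
      where
      another : Nonempty (X - e)
      another = ∣p∣≢0⇒Nonempty (X - e) λ ∣X-e∣≡0 → contradiction
        (trans (sym even) (cong isOdd (trans (∣p∣≡1+∣p-x∣ e∈X) (cong suc ∣X-e∣≡0)))) λ ()
      e′ = proj₁ another
      e′∈X-e = proj₂ another

-- Homology classes

module _ {n : ℕ} (K : SimplicialComplex n) {ζ : Chain K 1} where

  -- Homologous chains meet a cocycle in the same parity: ∂ c · η = c · δ η = 0.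
  class-parity : ∀ {η} → Is1Cocycle K η → ∀ {ζ′} → HomologyClass K ζ ζ′ → ζ · η ≡ ζ′ · η
  class-parity {η} cocycle {ζ′} (_ , c , ζ⊕ζ′≡∂c) = xor≡false⇒≡ (ζ · η) (ζ′ · η) (begin
    (ζ · η) xor (ζ′ · η) ≡⟨ ·-distribʳ-⊕ η ζ ζ′ ⟨
    (ζ ⊕ ζ′) · η         ≡⟨ cong (_· η) ζ⊕ζ′≡∂c ⟩
    ∂ K 1 c · η          ≡⟨ ∂-δ-adjoint K 1 c η ⟩
    c · δ K 1 η          ≡⟨ cong (c ·_) cocycle ⟩
    c · ⊥                ≡⟨ ·-zeroʳ c ⟩
    false                ∎)
    where
    xor≡false⇒≡ : ∀ x y → x xor y ≡ false → x ≡ y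
    xor≡false⇒≡ false false _ = refl
    xor≡false⇒≡ true  true  _ = refl

  class-refl : Is1Cycle K ζ → HomologyClass K ζ ζ
  class-refl cycle = cycle , ⊥ , trans (⊕-self ζ) (sym (∂⊥≡⊥ K 1))

  class-⊕-∂ : ∀ {ζ′} → HomologyClass K ζ ζ′ → ∀ c → HomologyClass K ζ (ζ′ ⊕ ∂ K 1 c)
  class-⊕-∂ {ζ′} (cycle , d , ζ⊕ζ′≡∂d) c =
      (begin
        ∂ K 0 (ζ′ ⊕ ∂ K 1 c)         ≡⟨ ∂-⊕ K 0 ζ′ (∂ K 1 c) ⟩
        ∂ K 0 ζ′ ⊕ ∂ K 0 (∂ K 1 c)   ≡⟨ cong₂ _⊕_ cycle (∂∂≡⊥ K 0 c) ⟩
        ⊥ ⊕ ⊥                        ≡⟨ ⊕-self ⊥ ⟩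
        ⊥                            ∎)
    , d ⊕ c , (begin
        ζ ⊕ (ζ′ ⊕ ∂ K 1 c)  ≡⟨ ⊕-assoc ζ ζ′ (∂ K 1 c) ⟨
        (ζ ⊕ ζ′) ⊕ ∂ K 1 c  ≡⟨ cong (_⊕ ∂ K 1 c) ζ⊕ζ′≡∂d ⟩
        ∂ K 1 d ⊕ ∂ K 1 c   ≡⟨ ∂-⊕ K 1 d c ⟨
        ∂ K 1 (d ⊕ c)       ∎)

  -- If ζ′ met η evenly, a boundary tracing ζ′ ∩ η on η could be added to ζ′, and
  -- the resulting homologous cycle would avoid η.
  feasible⇒odd : IsClosedSurface K → ∀ {η} → ConnectedCocycle K η → Feasible K ζ η →
    ∀ ζ′ → HomologyClass K ζ ζ′ → Odd ∣ ζ′ ∩ η ∣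
  feasible⇒odd surface {η} connected feasible ζ′ ζ′∈[ζ] with odd? ∣ ζ′ ∩ η ∣
  ... | yes odd = odd
  ... | no ¬odd =
    let (c , ∂c∩η≡ζ′∩η) = trace-even K η surface connected (p∩q⊆q ζ′ η) (dec-false (odd? ∣ ζ′ ∩ η ∣) ¬odd)
        (e , e∈) = feasible (ζ′ ⊕ ∂ K 1 c) (class-⊕-∂ ζ′∈[ζ] c)
    in contradiction (subst (e ∈_) (begin
         (ζ′ ⊕ ∂ K 1 c) ∩ η        ≡⟨ ∩-distribʳ-⊕ η ζ′ (∂ K 1 c) ⟩
         (ζ′ ∩ η) ⊕ (∂ K 1 c ∩ η)  ≡⟨ cong ((ζ′ ∩ η) ⊕_) ∂c∩η≡ζ′∩η ⟩
         (ζ′ ∩ η) ⊕ (ζ′ ∩ η)       ≡⟨ ⊕-self (ζ′ ∩ η) ⟩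
         ⊥                         ∎) e∈) ∉⊥

lemma15 : ∀ {n : ℕ} (K : SimplicialComplex n) → IsClosedSurface K →
    (ζ : Chain K 1) → Is1Cycle K ζ → ¬ Is1Boundary K ζ →
    (η : Cochain K 1) → ConnectedCocycle K η →
    (Feasible K ζ η ⇔ (∀ ζ′ → HomologyClass K ζ ζ′ → Odd ∣ ζ′ ∩ η ∣))
    × ((∀ ζ′ → HomologyClass K ζ ζ′ → Odd ∣ ζ′ ∩ η ∣) ⇔ (∃[ ζ′ ] HomologyClass K ζ ζ′ × Odd ∣ ζ′ ∩ η ∣))
lemma15 K surface ζ cycle _ η connected@(cocycle , _) =
    mk⇔ (feasible⇒odd K surface connected)
        (λ allOdd ζ′ ζ′∈[ζ] → ∣p∣≢0⇒Nonempty (ζ′ ∩ η) λ eq →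
          contradiction (subst Odd eq (allOdd ζ′ ζ′∈[ζ])) λ ())
  , mk⇔ (λ allOdd → let ζ∈[ζ] = class-refl K cycle in ζ , ζ∈[ζ] , allOdd ζ ζ∈[ζ])
        (λ (ζ₁ , ζ₁∈[ζ] , odd₁) ζ₂ ζ₂∈[ζ] → does-true⁻ (odd? ∣ ζ₂ ∩ η ∣) (begin
          ζ₂ · η ≡⟨ class-parity K cocycle ζ₂∈[ζ] ⟨
          ζ · η  ≡⟨ class-parity K cocycle ζ₁∈[ζ] ⟩
          ζ₁ · η ≡⟨ dec-true (odd? ∣ ζ₁ ∩ η ∣) odd₁ ⟩
          true   ∎))
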